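{- Let $F$ be a field of characteristic $0$, let $n\ge 0$, and let $(l^*_0,l^*_1,l^*_2,l^*_3)\in C_4(\mathbb{A}^2_{F[\varepsilon]_{n+1}})$ be four vectors in generic position, written $l^*_i=l_i+l_{i,\varepsilon}\varepsilon+l_{i,\varepsilon^2}\varepsilon^2+\cdots+l_{i,\varepsilon^n}\varepsilon^n$. Then, in $F[\varepsilon]_{n+1}$, $$\Delta(l^*_0,l^*_1)\,\Delta(l^*_2,l^*_3)=\Delta(l^*_0,l^*_2)\,\Delta(l^*_1,l^*_3)-\Delta(l^*_0,l^*_3)\,\Delta(l^*_1,l^*_2).$$
   Context: For $\nu\ge 1$, $F[\varepsilon]_\nu:=F[\varepsilon]/\varepsilon^\nu$ is the truncated polynomial ring. $C_m(\mathbb{A}^2_{F[\varepsilon]_{\nu}})$ is the free abelian group generated by configurations of $m$ vectors in the affine plane over $F[\varepsilon]_\nu$ in generic position. A vector is written $l^*_i=l_i+l_{i,\varepsilon}\varepsilon+\cdots+l_{i,\varepsilon^n}\varepsilon^n$ (with $\nu=n+1$), where $l_{i,\varepsilon^k}\in\mathbb{A}^2_F=F^2$ and $l_{i,\varepsilon^0}=l_i$. Generic position means $\Delta(l_i,l_j)\ne0$ for $i\neq j$. Here $\Delta(l_i,l_j)\in F$ denotes the $2\times 2$ determinant of $l_i,l_j\in F^2$ (the value of a fixed volume form on $l_i\wedge l_j$), and $$\Delta(l^*_i,l^*_j)=\Delta(l_i,l_j)+\Delta(l^*_i,l^*_j)_{\varepsilon}\,\varepsilon+\cdots+\Delta(l^*_i,l^*_j)_{\varepsilon^n}\,\varepsilon^n,$$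 where, for each $k$ with $0\le k\le n$, $\Delta(l^*_i,l^*_j)_{\varepsilon^k}=\Delta(l_i,l_{j,\varepsilon^k})+\Delta(l_{i,\varepsilon},l_{j,\varepsilon^{k-1}})+\cdots+\Delta(l_{i,\varepsilon^k},l_j)$. -}

module Defs where

open import Algebra.Apartness.Bundles using (HeytingField; HeytingCommutativeRing)
open import Algebra.Bundles using (CommutativeRing)
open import Algebra.Bundles.Raw using (RawRing)
import Algebra.Definitions.RawSemiring as RawSemiringDefinitions
open import Data.Fin.Base using (toℕ)
open import Data.List.Base using (List; []; _∷_; map; applyUpTo)
open import Data.Nat.Base using (ℕ; zero; suc; _∸_)
open import Data.Product.Base using (_×_; _,_)
open import Data.Vec.Functional using (Vector)
open import Level using (_⊔_)
open import Relation.Binary.PropositionalEquality.Core using (_≢_)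
open import Relation.Nullary.Negation.Core using (¬_)

fieldRing : ∀ {c ℓ₁ ℓ₂} → HeytingField c ℓ₁ ℓ₂ → CommutativeRing c ℓ₁
fieldRing F = HeytingCommutativeRing.commutativeRing (HeytingField.heytingCommutativeRing F)

CharacteristicZero : ∀ {c ℓ₁ ℓ₂} → HeytingField c ℓ₁ ℓ₂ → Set ℓ₁
CharacteristicZero F = ∀ k → ¬ ((suc k ·ℕ 1#) ≈ 0#)
  where
  open CommutativeRing (fieldRing F) using (_≈_; 0#; 1#; rawRing)
  open RawSemiringDefinitions (RawRing.rawSemiring rawRing) using () renaming (_×_ to _·ℕ_)

module Polynomial {c ℓ} (R : CommutativeRing c ℓ) where

  open CommutativeRing R

  -- a₀ ∷ a₁ ∷ … ∷ a_d ∷ [] stands for a₀ + a₁ε + ⋯ + a_d ε^d.  Trailing zeros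
  -- are allowed, so polynomials are compared by their coefficients.
  Poly : Set c
  Poly = List Carrier

  coeff : Poly → ℕ → Carrier
  coeff []      _       = 0#
  coeff (a ∷ p) zero    = a
  coeff (a ∷ p) (suc k) = coeff p k

  _≈ᴾ_ : Poly → Poly → Set ℓ
  p ≈ᴾ q = ∀ k → coeff p k ≈ coeff q k

  _+ᴾ_ : Poly → Poly → Poly
  []      +ᴾ q       = q
  (a ∷ p) +ᴾ []      = a ∷ p
  (a ∷ p) +ᴾ (b ∷ q) = (a + b) ∷ (p +ᴾ q)

  -ᴾ_ : Poly → Poly
  -ᴾ p = map (-_) p

  -- (a + ε p) q = a q + ε (p q)
  _*ᴾ_ : Poly → Poly → Poly
  []      *ᴾ q = []
  (a ∷ p) *ᴾ q = map (a *_) q +ᴾ (0# ∷ (p *ᴾ q))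

  polynomialRing : RawRing c ℓ
  polynomialRing = record
    { Carrier = Poly
    ; _≈_     = _≈ᴾ_
    ; _+_     = _+ᴾ_
    ; _*_     = _*ᴾ_
    ; -_      = -ᴾ_
    ; 0#      = []
    ; 1#      = 1# ∷ []
    }

  ε : Poly
  ε = 0# ∷ 1# ∷ []

  open RawSemiringDefinitions (RawRing.rawSemiring polynomialRing) using (_^_; _∣_)

  -- The quotient R[ε]/ε^ν, as a setoid: p and q are identified when their
  -- difference lies in the ideal generated by ε^ν.
  truncatedPolynomialRing : ℕ → RawRing c (c ⊔ ℓ)
  truncatedPolynomialRing ν = record
    { Carrier = Poly
    ; _≈_     = λ p q → (ε ^ ν) ∣ (p +ᴾ (-ᴾ q))
    ; _+_     = _+ᴾ_
    ; _*_     = _*ᴾ_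
    ; -_      = -ᴾ_
    ; 0#      = []
    ; 1#      = 1# ∷ []
    }

𝔸² : ∀ {c ℓ} → RawRing c ℓ → Set c
𝔸² R = RawRing.Carrier R × RawRing.Carrier R

module Plane {c ℓ₁ ℓ₂} (F : HeytingField c ℓ₁ ℓ₂) (n : ℕ) where

  open CommutativeRing (fieldRing F)
  open Polynomial (fieldRing F) using (coeff; truncatedPolynomialRing)
  open RawSemiringDefinitions (RawRing.rawSemiring rawRing) using (sum)

  F[ε] : RawRing c (c ⊔ ℓ₁)
  F[ε] = truncatedPolynomialRing (suc n)

  Δ : 𝔸² rawRing → 𝔸² rawRing → Carrier
  Δ (x₁ , y₁) (x₂ , y₂) = x₁ * y₂ - y₁ * x₂

  -- l at k is the vector coefficient of ε^k in l.  For k ≤ n it does not depend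
  -- on the polynomials representing l; only such k are used below.
  _at_ : 𝔸² F[ε] → ℕ → 𝔸² rawRing
  (x , y) at k = coeff x k , coeff y k

  Δ-coeff : 𝔸² F[ε] → 𝔸² F[ε] → ℕ → Carrier
  Δ-coeff l l′ k = sum {suc k} λ j → Δ (l at toℕ j) (l′ at (k ∸ toℕ j))

  -- The element of F[ε]/ε^(n+1) with coefficients Δ-coeff l l′ 0, …, Δ-coeff l l′ n.
  Δ* : 𝔸² F[ε] → 𝔸² F[ε] → RawRing.Carrier F[ε]
  Δ* l l′ = applyUpTo (Δ-coeff l l′) (suc n)

  GenericPosition : ∀ {m} → Vector (𝔸² F[ε]) m → Set ℓ₁
  GenericPosition l = ∀ i j → i ≢ j → ¬ (Δ (l i at 0) (l j at 0) ≈ 0#)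

  -- The generators of the free abelian group C_m(𝔸²) over F[ε]/ε^(n+1).
  record Configuration (m : ℕ) : Set (c ⊔ ℓ₁) where
    field
      vectors         : Vector (𝔸² F[ε]) m
      genericPosition : GenericPosition vectors

{-# OPTIONS --safe #-}
-- Comparing coefficients, Δ(l, l′) = x y′ - y x′ for l = (x, y) and l′ = (x′, y′)
-- in the commutative ring F[ε]/ε^(n+1).  The claim is then the Plücker relation
-- for the 2×2 minors of a 2×4 matrix, which holds over every commutative ring.
module Submission where

open import Defs
open import Algebra.Apartness.Bundles using (HeytingField)
open import Algebra.Bundles using (AbelianGroup; CommutativeRing)
open import Algebra.Bundles.Raw using (RawRing)
open import Algebra.Consequences.Setoid using (comm∧idˡ⇒id; comm∧distrʳ⇒distr)
open import Algebra.Definitions.RawMagma using (_,_)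
import Algebra.Definitions.RawSemiring as RawSemiringDefinitions
import Algebra.Properties.CommutativeMonoid.Sum as Sum
import Algebra.Properties.CommutativeSemigroup as CommutativeSemigroupProperties
import Algebra.Properties.Ring as RingProperties
import Algebra.Properties.Semiring.Sum as SemiringSum
import Algebra.Solver.Ring.NaturalCoefficients.Default as NaturalCoefficients
open import Data.Fin.Base using (toℕ)
open import Data.Fin.Patterns using (0F; 1F; 2F; 3F)
open import Data.Fin.Properties using (toℕ<n)
open import Data.List.Base using ([]; _∷_; map; applyUpTo)
open import Data.Nat.Base using (ℕ; zero; suc; _∸_; _<_; s≤s; z≤n; s≤s⁻¹)
open import Data.Nat.Properties using (≤-trans; ≤-<-trans; n≤1+n; n<1+n; m∸n≤m)
open import Data.Product.Base using (_,_)
open import Data.Vec.Functional using (Vector)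
open import Relation.Binary.PropositionalEquality.Core as ≡ using (_≡_)
import Relation.Binary.Reasoning.Setoid as SetoidReasoning

-- The three-term Plücker relation over an arbitrary commutative ring.

module Plücker {c ℓ} (R : CommutativeRing c ℓ) where

  open CommutativeRing R
  open RingProperties ring using (-‿distribˡ-*; //-rightDividesʳ)
  open SetoidReasoning setoid

  det : 𝔸² rawRing → 𝔸² rawRing → Carrier
  det (x₁ , y₁) (x₂ , y₂) = x₁ * y₂ - y₁ * x₂

  private
    -- With zᵢ in place of - yᵢ, so that no subtraction occurs and the semiring solver
    -- applies; the terms with a factor yᵢ + zᵢ vanish for zᵢ = - yᵢ.
    plücker-semiring : ∀ x₀ x₁ x₂ x₃ y₁ y₂ y₃ z₀ z₁ z₂ →
      ((x₀ * y₁ + z₀ * x₁) * (x₂ * y₃ + z₂ * x₃) + (x₀ * y₃ + z₀ * x₃) * (x₁ * y₂ + z₁ * x₂))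
        + (y₁ + z₁) * (x₀ * x₃ * y₂)
      ≈ (x₀ * y₂ + z₀ * x₂) * (x₁ * y₃ + z₁ * x₃)
        + ((y₁ + z₁) * (x₀ * x₂ * y₃) + (y₂ + z₂) * (x₁ * x₃ * z₀ + x₀ * x₃ * y₁))
    plücker-semiring = solve 10 (λ x₀ x₁ x₂ x₃ y₁ y₂ y₃ z₀ z₁ z₂ →
      ((x₀ :* y₁ :+ z₀ :* x₁) :* (x₂ :* y₃ :+ z₂ :* x₃) :+ (x₀ :* y₃ :+ z₀ :* x₃) :* (x₁ :* y₂ :+ z₁ :* x₂))
        :+ (y₁ :+ z₁) :* (x₀ :* x₃ :* y₂)
      := (x₀ :* y₂ :+ z₀ :* x₂) :* (x₁ :* y₃ :+ z₁ :* x₃)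
        :+ ((y₁ :+ z₁) :* (x₀ :* x₂ :* y₃) :+ (y₂ :+ z₂) :* (x₁ :* x₃ :* z₀ :+ x₀ :* x₃ :* y₁))) refl
      where open NaturalCoefficients commutativeSemiring

  -- Moving the subtracted product to the left leaves `three-term`, whose only minus signs are those
  -- inside the determinants; right cancellation in the additive group then restores the difference.
  plücker : ∀ u₀ u₁ u₂ u₃ →
    det u₀ u₁ * det u₂ u₃ ≈ det u₀ u₂ * det u₁ u₃ - det u₀ u₃ * det u₁ u₂
  plücker u₀@(x₀ , y₀) u₁@(x₁ , y₁) u₂@(x₂ , y₂) u₃@(x₃ , y₃) = begin
    det u₀ u₁ * det u₂ u₃                            ≈⟨ //-rightDividesʳ _ _ ⟨
    det u₀ u₁ * det u₂ u₃ + det u₀ u₃ * det u₁ u₂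
      - det u₀ u₃ * det u₁ u₂                        ≈⟨ +-congʳ three-term ⟩
    det u₀ u₂ * det u₁ u₃ - det u₀ u₃ * det u₁ u₂    ∎
    where
    det′ : 𝔸² rawRing → 𝔸² rawRing → Carrier
    det′ (x , y) (x′ , y′) = x * y′ + - y * x′

    det≈det′ : ∀ u v → det u v ≈ det′ u v
    det≈det′ (x , y) (x′ , y′) = +-congˡ (-‿distribˡ-* y x′)

    det*det≈det′*det′ : ∀ u v w t → det u v * det w t ≈ det′ u v * det′ w t
    det*det≈det′*det′ u v w t = *-cong (det≈det′ u v) (det≈det′ w t)

    cancel : ∀ y a → (y - y) * a ≈ 0#
    cancel y a = trans (*-congʳ (-‿inverseʳ y)) (zeroˡ a)

    three-term : det u₀ u₁ * det u₂ u₃ + det u₀ u₃ * det u₁ u₂ ≈ det u₀ u₂ * det u₁ u₃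
    three-term = begin
      det u₀ u₁ * det u₂ u₃ + det u₀ u₃ * det u₁ u₂
        ≈⟨ +-cong (det*det≈det′*det′ u₀ u₁ u₂ u₃) (det*det≈det′*det′ u₀ u₃ u₁ u₂) ⟩
      det′ u₀ u₁ * det′ u₂ u₃ + det′ u₀ u₃ * det′ u₁ u₂
        ≈⟨ +-identityʳ _ ⟨
      det′ u₀ u₁ * det′ u₂ u₃ + det′ u₀ u₃ * det′ u₁ u₂ + 0#
        -- The semiring identity carries a correction term on its left side as well, so a vanishing
        -- multiple of `y₁ - y₁` is inserted to match it.
        ≈⟨ +-congˡ (cancel y₁ _) ⟨
      det′ u₀ u₁ * det′ u₂ u₃ + det′ u₀ u₃ * det′ u₁ u₂ + (y₁ - y₁) * (x₀ * x₃ * y₂)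
        -- The vector `u₀` always stands first in its determinant and `u₃` always last. Hence the
        -- identity has no variable for `y₀` itself, only for `- y₀`, and none for `- y₃`.
        ≈⟨ plücker-semiring x₀ x₁ x₂ x₃ y₁ y₂ y₃ (- y₀) (- y₁) (- y₂) ⟩
      det′ u₀ u₂ * det′ u₁ u₃ + ((y₁ - y₁) * (x₀ * x₂ * y₃) + (y₂ - y₂) * (x₁ * x₃ * - y₀ + x₀ * x₃ * y₁))
        ≈⟨ +-congˡ (+-cong (cancel y₁ _) (cancel y₂ _)) ⟩
      det′ u₀ u₂ * det′ u₁ u₃ + (0# + 0#)
        ≈⟨ +-congˡ (+-identityˡ 0#) ⟩
      det′ u₀ u₂ * det′ u₁ u₃ + 0#
        ≈⟨ +-identityʳ _ ⟩
      det′ u₀ u₂ * det′ u₁ u₃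
        ≈⟨ det*det≈det′*det′ u₀ u₂ u₁ u₃ ⟨
      det u₀ u₂ * det u₁ u₃ ∎

-- Coefficients of sums, negatives, multiples and products of polynomials.

module Coefficients {c ℓ} (R : CommutativeRing c ℓ) where

  open CommutativeRing R
  open Polynomial R
  open RingProperties ring using (-0#≈0#)
  open RawSemiringDefinitions (RawRing.rawSemiring rawRing) using (sum)
  open Sum +-commutativeMonoid using (sum-replicate-zero; sum-cong-≋)
  open SetoidReasoning setoid

  coeff-+ : ∀ p q k → coeff (p +ᴾ q) k ≈ coeff p k + coeff q k
  coeff-+ []      q       k       = sym (+-identityˡ _)
  coeff-+ (a ∷ p) []      k       = sym (+-identityʳ _)
  coeff-+ (a ∷ p) (b ∷ q) zero    = refl
  coeff-+ (a ∷ p) (b ∷ q) (suc k) = coeff-+ p q k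

  coeff-neg : ∀ p k → coeff (-ᴾ p) k ≈ - coeff p k
  coeff-neg []      k       = sym -0#≈0#
  coeff-neg (a ∷ p) zero    = refl
  coeff-neg (a ∷ p) (suc k) = coeff-neg p k

  coeff-scale : ∀ a p k → coeff (map (a *_) p) k ≈ a * coeff p k
  coeff-scale a []      k       = sym (zeroʳ a)
  coeff-scale a (b ∷ p) zero    = refl
  coeff-scale a (b ∷ p) (suc k) = coeff-scale a p k

  products : Poly → Poly → (k : ℕ) → Vector Carrier (suc k)
  products p q k j = coeff p (toℕ j) * coeff q (k ∸ toℕ j)

  -- The recursion defining `_*ᴾ_` matches splitting off the summand for exponent 0 from the Cauchy
  -- product: in the remaining summands `suc k ∸ suc j` reduces to `k ∸ j`, which is the convolution
  -- for the tail of the first factor.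
  coeff-* : ∀ p q k → coeff (p *ᴾ q) k ≈ sum (products p q k)
  coeff-* []      q k = sym (trans
    (sum-cong-≋ {suc k} λ j → zeroˡ (coeff q (k ∸ toℕ j))) (sum-replicate-zero (suc k)))
  coeff-* (a ∷ p) q zero = begin
    coeff (map (a *_) q +ᴾ (0# ∷ p *ᴾ q)) 0  ≈⟨ coeff-+ (map (a *_) q) _ 0 ⟩
    coeff (map (a *_) q) 0 + 0#              ≈⟨ +-congʳ (coeff-scale a q 0) ⟩
    -- The final `0#`, the head of the shifted product, is also the empty sum ending the one-term
    -- convolution.
    a * coeff q 0 + 0#                       ∎
  coeff-* (a ∷ p) q (suc k) = begin
    coeff (map (a *_) q +ᴾ (0# ∷ p *ᴾ q)) (suc k)
      ≈⟨ coeff-+ (map (a *_) q) _ (suc k) ⟩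
    coeff (map (a *_) q) (suc k) + coeff (p *ᴾ q) k
      ≈⟨ +-cong (coeff-scale a q (suc k)) (coeff-* p q k) ⟩
    a * coeff q (suc k) + sum (products p q k) ∎

  coeff-applyUpTo : ∀ f {m k} → k < m → coeff (applyUpTo f m) k ≡ f k
  coeff-applyUpTo f {suc m} {zero}  _   = ≡.refl
  coeff-applyUpTo f {suc m} {suc k} k<m = coeff-applyUpTo (λ j → f (suc j)) (s≤s⁻¹ k<m)

-- The commutative ring of polynomials compared in degrees below `ν`.

module Truncation {c ℓ} (R : CommutativeRing c ℓ) (ν : ℕ) where

  open CommutativeRing R
  open Polynomial R
  open Coefficients R
  open RawSemiringDefinitions (RawRing.rawSemiring rawRing) using (sum)
  open Sum +-commutativeMonoid using (sum-cong-≋; ∑-distrib-+)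
  open SemiringSum semiring using (*-distribˡ-sum)

  -- Equality modulo ε^ν, as a record so that p and q can be inferred.
  infix 4 _≈ₜ_
  record _≈ₜ_ (p q : Poly) : Set ℓ where
    constructor coefficientwise
    field
      coeff-cong : ∀ {k} → k < ν → coeff p k ≈ coeff q k
  open _≈ₜ_ public

  ≈ᴾ⇒≈ₜ : ∀ {p q} → p ≈ᴾ q → p ≈ₜ q
  ≈ᴾ⇒≈ₜ p≈q = coefficientwise λ {k} _ → p≈q k

  ∷-cong : ∀ {a b p q} → a ≈ b → p ≈ₜ q → (a ∷ p) ≈ₜ (b ∷ q)
  ∷-cong {a} {b} {p} {q} a≈b p≈q = coefficientwise coeffs
    where
    coeffs : ∀ {k} → k < ν → coeff (a ∷ p) k ≈ coeff (b ∷ q) k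
    coeffs {zero}  _   = a≈b
    coeffs {suc k} k<ν = coeff-cong p≈q (≤-trans (n≤1+n (suc k)) k<ν)

  0∷[]≈[] : (0# ∷ []) ≈ₜ []
  0∷[]≈[] = ≈ᴾ⇒≈ₜ λ { zero → refl ; (suc _) → refl }

  +ᴾ-abelianGroup : AbelianGroup c ℓ
  +ᴾ-abelianGroup = record
    { Carrier = Poly
    ; _≈_ = _≈ₜ_
    ; _∙_ = _+ᴾ_
    ; ε = []
    ; _⁻¹ = -ᴾ_
    ; isAbelianGroup = record
      { isGroup = record
        { isMonoid = record
          { isSemigroup = record
            { isMagma = record
              { isEquivalence = record
                { refl = ≈ᴾ⇒≈ₜ λ _ → refl
                ; sym = λ p≈q → coefficientwise λ k<ν → sym (coeff-cong p≈q k<ν)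
                ; trans = λ p≈q q≈r → coefficientwise λ k<ν →
                    trans (coeff-cong p≈q k<ν) (coeff-cong q≈r k<ν)
                }
              ; ∙-cong = λ {p} {q} {r} {s} p≈q r≈s → coefficientwise λ {k} k<ν → begin
                  coeff (p +ᴾ r) k       ≈⟨ coeff-+ p r k ⟩
                  coeff p k + coeff r k  ≈⟨ +-cong (coeff-cong p≈q k<ν) (coeff-cong r≈s k<ν) ⟩
                  coeff q k + coeff s k  ≈⟨ coeff-+ q s k ⟨
                  coeff (q +ᴾ s) k       ∎
              }
            ; assoc = λ p q r → ≈ᴾ⇒≈ₜ λ k → begin
                coeff ((p +ᴾ q) +ᴾ r) k              ≈⟨ coeff-+ (p +ᴾ q) r k ⟩
                coeff (p +ᴾ q) k + coeff r k         ≈⟨ +-congʳ (coeff-+ p q k) ⟩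
                coeff p k + coeff q k + coeff r k    ≈⟨ +-assoc _ _ _ ⟩
                coeff p k + (coeff q k + coeff r k)  ≈⟨ +-congˡ (coeff-+ q r k) ⟨
                coeff p k + coeff (q +ᴾ r) k         ≈⟨ coeff-+ p (q +ᴾ r) k ⟨
                coeff (p +ᴾ (q +ᴾ r)) k              ∎
            }
          ; identity = (λ p → ≈ᴾ⇒≈ₜ λ _ → refl)
                     , (λ p → ≈ᴾ⇒≈ₜ λ k → trans (coeff-+ p [] k) (+-identityʳ _))
          }
        ; inverse = (λ p → ≈ᴾ⇒≈ₜ λ k → begin
                      coeff ((-ᴾ p) +ᴾ p) k        ≈⟨ coeff-+ (-ᴾ p) p k ⟩
                      coeff (-ᴾ p) k + coeff p k   ≈⟨ +-congʳ (coeff-neg p k) ⟩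
                      - coeff p k + coeff p k      ≈⟨ -‿inverseˡ _ ⟩
                      0#                           ∎)
                  , (λ p → ≈ᴾ⇒≈ₜ λ k → begin
                      coeff (p +ᴾ (-ᴾ p)) k        ≈⟨ coeff-+ p (-ᴾ p) k ⟩
                      coeff p k + coeff (-ᴾ p) k   ≈⟨ +-congˡ (coeff-neg p k) ⟩
                      coeff p k - coeff p k        ≈⟨ -‿inverseʳ _ ⟩
                      0#                           ∎)
        ; ⁻¹-cong = λ {p} {q} p≈q → coefficientwise λ {k} k<ν → begin
            coeff (-ᴾ p) k  ≈⟨ coeff-neg p k ⟩
            - coeff p k     ≈⟨ -‿cong (coeff-cong p≈q k<ν) ⟩
            - coeff q k     ≈⟨ coeff-neg q k ⟨
            coeff (-ᴾ q) k  ∎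
        }
      ; comm = λ p q → ≈ᴾ⇒≈ₜ λ k → begin
          coeff (p +ᴾ q) k       ≈⟨ coeff-+ p q k ⟩
          coeff p k + coeff q k  ≈⟨ +-comm _ _ ⟩
          coeff q k + coeff p k  ≈⟨ coeff-+ q p k ⟨
          coeff (q +ᴾ p) k       ∎
      }
    }
    where open SetoidReasoning setoid

  open AbelianGroup +ᴾ-abelianGroup public using () renaming
    ( setoid to ≈ₜ-setoid; refl to ≈ₜ-refl; sym to ≈ₜ-sym; trans to ≈ₜ-trans
    ; ∙-cong to +ᴾ-cong; ∙-congˡ to +ᴾ-congˡ; ∙-congʳ to +ᴾ-congʳ; assoc to +ᴾ-assoc
    ; identityʳ to +ᴾ-identityʳ; commutativeSemigroup to +ᴾ-commutativeSemigroup )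
  open CommutativeSemigroupProperties +ᴾ-commutativeSemigroup using (x∙yz≈y∙xz)

  -- The coefficient of degree `k` in a product involves only the degrees `j` and `k ∸ j` of its
  -- factors, and both stay below `ν` when `k` does.
  *ᴾ-cong : ∀ {p q r s} → p ≈ₜ q → r ≈ₜ s → (p *ᴾ r) ≈ₜ (q *ᴾ s)
  *ᴾ-cong {p} {q} {r} {s} p≈q r≈s = coefficientwise λ {k} k<ν → begin
    coeff (p *ᴾ r) k
      ≈⟨ coeff-* p r k ⟩
    sum (products p r k)
      ≈⟨ sum-cong-≋ {suc k} (λ j → *-cong
           (coeff-cong p≈q (≤-<-trans (s≤s⁻¹ (toℕ<n j)) k<ν))
           (coeff-cong r≈s (≤-<-trans (m∸n≤m k (toℕ j)) k<ν))) ⟩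
    sum (products q s k)
      ≈⟨ coeff-* q s k ⟨
    coeff (q *ᴾ s) k ∎
    where open SetoidReasoning setoid

  *ᴾ-distribʳ : ∀ r p q → ((p +ᴾ q) *ᴾ r) ≈ₜ ((p *ᴾ r) +ᴾ (q *ᴾ r))
  *ᴾ-distribʳ r p q = ≈ᴾ⇒≈ₜ λ k → begin
    coeff ((p +ᴾ q) *ᴾ r) k
      ≈⟨ coeff-* (p +ᴾ q) r k ⟩
    sum (products (p +ᴾ q) r k)
      ≈⟨ sum-cong-≋ {suc k} (λ j → trans (*-congʳ (coeff-+ p q (toℕ j))) (distribʳ (coeff r (k ∸ toℕ j)) _ _)) ⟩
    sum (λ j → products p r k j + products q r k j)
      ≈⟨ ∑-distrib-+ (products p r k) (products q r k) ⟩
    sum (products p r k)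
      + sum (products q r k)
      ≈⟨ +-cong (coeff-* p r k) (coeff-* q r k) ⟨
    coeff (p *ᴾ r) k + coeff (q *ᴾ r) k
      ≈⟨ coeff-+ (p *ᴾ r) (q *ᴾ r) k ⟨
    coeff ((p *ᴾ r) +ᴾ (q *ᴾ r)) k ∎
    where open SetoidReasoning setoid

  -- Since `a ∷ p` stands for `a + ε p`, this and `shift-*ᴾ` handle the two summands in the
  -- inductive step of associativity.
  scale-*ᴾ : ∀ a p q → (map (a *_) p *ᴾ q) ≈ₜ map (a *_) (p *ᴾ q)
  scale-*ᴾ a p q = ≈ᴾ⇒≈ₜ λ k → begin
    coeff (map (a *_) p *ᴾ q) k
      ≈⟨ coeff-* (map (a *_) p) q k ⟩
    sum (products (map (a *_) p) q k)
      ≈⟨ sum-cong-≋ {suc k} (λ j → trans (*-congʳ (coeff-scale a p (toℕ j))) (*-assoc _ _ (coeff q (k ∸ toℕ j)))) ⟩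
    sum (λ j → a * products p q k j)
      ≈⟨ *-distribˡ-sum a (products p q k) ⟨
    a * sum (products p q k)
      ≈⟨ *-congˡ (coeff-* p q k) ⟨
    a * coeff (p *ᴾ q) k
      ≈⟨ coeff-scale a (p *ᴾ q) k ⟨
    coeff (map (a *_) (p *ᴾ q)) k ∎
    where open SetoidReasoning setoid

  shift-*ᴾ : ∀ p q → ((0# ∷ p) *ᴾ q) ≈ₜ (0# ∷ p *ᴾ q)
  shift-*ᴾ p q = ≈ᴾ⇒≈ₜ λ k → begin
    coeff (map (0# *_) q +ᴾ (0# ∷ p *ᴾ q)) k         ≈⟨ coeff-+ (map (0# *_) q) _ k ⟩
    coeff (map (0# *_) q) k + coeff (0# ∷ p *ᴾ q) k  ≈⟨ +-congʳ (coeff-scale 0# q k) ⟩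
    0# * coeff q k + coeff (0# ∷ p *ᴾ q) k           ≈⟨ +-congʳ (zeroˡ _) ⟩
    0# + coeff (0# ∷ p *ᴾ q) k                       ≈⟨ +-identityˡ _ ⟩
    coeff (0# ∷ p *ᴾ q) k                            ∎
    where open SetoidReasoning setoid

  open SetoidReasoning ≈ₜ-setoid

  -- Induction on the first factor with right distributivity avoids reindexing a double convolution.
  *ᴾ-assoc : ∀ p q r → ((p *ᴾ q) *ᴾ r) ≈ₜ (p *ᴾ (q *ᴾ r))
  *ᴾ-assoc []      q r = ≈ₜ-refl
  *ᴾ-assoc (a ∷ p) q r = begin
    (map (a *_) q +ᴾ (0# ∷ p *ᴾ q)) *ᴾ r           ≈⟨ *ᴾ-distribʳ r (map (a *_) q) _ ⟩
    (map (a *_) q *ᴾ r) +ᴾ ((0# ∷ p *ᴾ q) *ᴾ r)    ≈⟨ +ᴾ-cong (scale-*ᴾ a q r) (shift-*ᴾ (p *ᴾ q) r) ⟩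
    map (a *_) (q *ᴾ r) +ᴾ (0# ∷ (p *ᴾ q) *ᴾ r)    ≈⟨ +ᴾ-congˡ (∷-cong refl (*ᴾ-assoc p q r)) ⟩
    map (a *_) (q *ᴾ r) +ᴾ (0# ∷ p *ᴾ (q *ᴾ r))    ∎

  *ᴾ-zeroʳ : ∀ p → (p *ᴾ []) ≈ₜ []
  *ᴾ-zeroʳ []      = ≈ₜ-refl
  *ᴾ-zeroʳ (a ∷ p) = ≈ₜ-trans (∷-cong refl (*ᴾ-zeroʳ p)) 0∷[]≈[]

  -- This mirrors the defining recursion of `_*ᴾ_` in the second factor. Commutativity follows by
  -- comparing the two recursions.
  *ᴾ-∷ : ∀ p b q → (p *ᴾ (b ∷ q)) ≈ₜ (map (b *_) p +ᴾ (0# ∷ p *ᴾ q))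
  *ᴾ-∷ []      b q = ≈ₜ-sym 0∷[]≈[]
  *ᴾ-∷ (a ∷ p) b q = ∷-cong (+-congʳ (*-comm a b)) (begin
    map (a *_) q +ᴾ (p *ᴾ (b ∷ q))                    ≈⟨ +ᴾ-congˡ (*ᴾ-∷ p b q) ⟩
    map (a *_) q +ᴾ (map (b *_) p +ᴾ (0# ∷ p *ᴾ q))   ≈⟨ x∙yz≈y∙xz (map (a *_) q) (map (b *_) p) _ ⟩
    map (b *_) p +ᴾ (map (a *_) q +ᴾ (0# ∷ p *ᴾ q))   ∎)

  *ᴾ-comm : ∀ p q → (p *ᴾ q) ≈ₜ (q *ᴾ p)
  *ᴾ-comm []      q = ≈ₜ-sym (*ᴾ-zeroʳ q)
  *ᴾ-comm (a ∷ p) q = begin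
    map (a *_) q +ᴾ (0# ∷ p *ᴾ q)  ≈⟨ +ᴾ-congˡ (∷-cong refl (*ᴾ-comm p q)) ⟩
    map (a *_) q +ᴾ (0# ∷ q *ᴾ p)  ≈⟨ *ᴾ-∷ q a p ⟨
    q *ᴾ (a ∷ p)                   ∎

  *ᴾ-identityˡ : ∀ p → ((1# ∷ []) *ᴾ p) ≈ₜ p
  *ᴾ-identityˡ p = begin
    map (1# *_) p +ᴾ (0# ∷ [])  ≈⟨ +ᴾ-congˡ 0∷[]≈[] ⟩
    map (1# *_) p +ᴾ []         ≈⟨ +ᴾ-identityʳ _ ⟩
    map (1# *_) p               ≈⟨ ≈ᴾ⇒≈ₜ (λ k → trans (coeff-scale 1# p k) (*-identityˡ _)) ⟩
    p                           ∎

  commutativeRing : CommutativeRing c ℓ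
  commutativeRing = record
    { Carrier = Poly
    ; _≈_ = _≈ₜ_
    ; _+_ = _+ᴾ_
    ; _*_ = _*ᴾ_
    ; -_ = -ᴾ_
    ; 0# = []
    ; 1# = 1# ∷ []
    ; isCommutativeRing = record
      { isRing = record
        { +-isAbelianGroup = AbelianGroup.isAbelianGroup +ᴾ-abelianGroup
        ; *-cong = *ᴾ-cong
        ; *-assoc = *ᴾ-assoc
        ; *-identity = comm∧idˡ⇒id ≈ₜ-setoid *ᴾ-comm *ᴾ-identityˡ
        ; distrib = comm∧distrʳ⇒distr ≈ₜ-setoid +ᴾ-cong *ᴾ-comm *ᴾ-distribʳ
        }
      ; *-comm = *ᴾ-comm
      }
    }

-- From agreement of low coefficients to divisibility by a power of `ε`.

module Quotient {c ℓ} (R : CommutativeRing c ℓ) where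

  open CommutativeRing R
  open Polynomial R
  open Coefficients R
  open RingProperties ring using (x≈y⇒x∙y⁻¹≈ε)
  open RawSemiringDefinitions (RawRing.rawSemiring polynomialRing) using (_^_; _∣_)

  module _ {ν : ℕ} where
    open Truncation R ν
    open SetoidReasoning ≈ₜ-setoid

    -- Divisibility by `ε ^ suc ν` asks for a cofactor on the left of `ε *ᴾ (ε ^ ν)`; pulling the
    -- inner `ε` to the front turns it into a shift.
    *ᴾ-ε* : ∀ p q → (p *ᴾ (ε *ᴾ q)) ≈ₜ (0# ∷ p *ᴾ q)
    *ᴾ-ε* p q = begin
      p *ᴾ (ε *ᴾ q)               ≈⟨ *ᴾ-comm p (ε *ᴾ q) ⟩
      (ε *ᴾ q) *ᴾ p               ≈⟨ *ᴾ-assoc ε q p ⟩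
      ε *ᴾ (q *ᴾ p)               ≈⟨ shift-*ᴾ (1# ∷ []) (q *ᴾ p) ⟩
      0# ∷ (1# ∷ []) *ᴾ (q *ᴾ p)  ≈⟨ ∷-cong refl (*ᴾ-identityˡ (q *ᴾ p)) ⟩
      0# ∷ q *ᴾ p                 ≈⟨ ∷-cong refl (*ᴾ-comm q p) ⟩
      0# ∷ p *ᴾ q                 ∎

  -- The cofactor is `p` with its first `ν` entries dropped: each inductive step removes one
  -- vanishing head, which accounts for one factor `ε`.
  ε^ν∣ : ∀ ν p → (∀ {k} → k < ν → coeff p k ≈ 0#) → (ε ^ ν) ∣ p
  -- Divisibility demands equality of all coefficients, while the ring laws are available only
  -- modulo a power of `ε`. Degree `k` is therefore read off in the ring truncated at `suc k`.
  ε^ν∣ zero    p       _    = p , λ k →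
    coeff-cong (CommutativeRing.*-identityʳ (commutativeRing (suc k)) p) (n<1+n k)
    where open Truncation R
  ε^ν∣ (suc ν) []      _    = [] , λ _ → refl
  ε^ν∣ (suc ν) (a ∷ p) p≈0 with ε^ν∣ ν p (λ k<ν → p≈0 (s≤s k<ν))
  ... | q , qε^ν≈p = q , λ k → trans (coeff-cong (*ᴾ-ε* q (ε ^ ν)) (n<1+n k)) (coeffs k)
    where
    open Truncation R
    coeffs : ∀ k → coeff (0# ∷ q *ᴾ (ε ^ ν)) k ≈ coeff (a ∷ p) k
    coeffs zero    = sym (p≈0 (s≤s z≤n))
    coeffs (suc k) = qε^ν≈p k

  -- The coefficients of the difference vanish below `ν`, so `ε^ν∣` supplies the cofactor.
  ≈ₜ⇒≈ : ∀ ν {p q} → Truncation._≈ₜ_ R ν p q → RawRing._≈_ (truncatedPolynomialRing ν) p q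
  ≈ₜ⇒≈ ν {p} {q} p≈q = ε^ν∣ ν (p +ᴾ (-ᴾ q)) λ {k} k<ν → begin
    coeff (p +ᴾ (-ᴾ q)) k       ≈⟨ coeff-+ p (-ᴾ q) k ⟩
    coeff p k + coeff (-ᴾ q) k  ≈⟨ +-congˡ (coeff-neg q k) ⟩
    coeff p k - coeff q k       ≈⟨ x≈y⇒x∙y⁻¹≈ε (Truncation.coeff-cong p≈q k<ν) ⟩
    0#                          ∎
    where open SetoidReasoning setoid

-- `Δ*` as a 2×2 determinant over the truncated polynomials.

module Determinant {c ℓ₁ ℓ₂} (F : HeytingField c ℓ₁ ℓ₂) (n : ℕ) where

  open Plane F n
  open CommutativeRing (fieldRing F)
  open Polynomial (fieldRing F)
  open Coefficients (fieldRing F)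
  open Truncation (fieldRing F) (suc n) using (_≈ₜ_; coefficientwise; commutativeRing)
  open Plücker commutativeRing using (det)
  open RingProperties ring using (-‿distribˡ-*)
  open RawSemiringDefinitions (RawRing.rawSemiring rawRing) using (sum)
  open Sum +-commutativeMonoid using (sum-cong-≋; ∑-distrib-+)

  -- Each `Δ-coeff` is a difference of two convolutions, namely those giving the coefficients of
  -- `x *ᴾ y′` and `y *ᴾ x′`.
  Δ*≈det : ∀ l l′ → Δ* l l′ ≈ₜ det l l′
  Δ*≈det l@(x , y) l′@(x′ , y′) = ≈ₜ-trans
    (coefficientwise λ {k} k<ν → trans
      (reflexive (coeff-applyUpTo (Δ-coeff l l′) k<ν)) (Δ-coeff≈ k))
    (≈ₜ.+-congˡ (≈ₜ.sym (-‿distribˡ-*ᴾ y x′)))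
    where
    module ≈ₜ = CommutativeRing commutativeRing
    open ≈ₜ using () renaming (trans to ≈ₜ-trans)
    open RingProperties ≈ₜ.ring using () renaming (-‿distribˡ-* to -‿distribˡ-*ᴾ)
    open SetoidReasoning setoid

    Δ-coeff≈ : ∀ k → Δ-coeff l l′ k ≈ coeff ((x *ᴾ y′) +ᴾ ((-ᴾ y) *ᴾ x′)) k
    Δ-coeff≈ k = begin
      sum (λ j → products x y′ k j - products y x′ k j)
        -- The sign is absorbed into `y`, so that the sum of differences becomes a sum of sums and
        -- splits by `∑-distrib-+`.
        ≈⟨ sum-cong-≋ {suc k} (λ j → +-congˡ {products x y′ k j}
             (trans (-‿distribˡ-* _ (coeff x′ (k ∸ toℕ j))) (*-congʳ (sym (coeff-neg y (toℕ j)))))) ⟩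
      sum (λ j → products x y′ k j + products (-ᴾ y) x′ k j)
        ≈⟨ ∑-distrib-+ (products x y′ k) (products (-ᴾ y) x′ k) ⟩
      sum (products x y′ k)
        + sum (products (-ᴾ y) x′ k)
        ≈⟨ +-cong (coeff-* x y′ k) (coeff-* (-ᴾ y) x′ k) ⟨
      coeff (x *ᴾ y′) k + coeff ((-ᴾ y) *ᴾ x′) k
        ≈⟨ coeff-+ (x *ᴾ y′) _ k ⟨
      coeff ((x *ᴾ y′) +ᴾ ((-ᴾ y) *ᴾ x′)) k ∎

lemma2p1 : ∀ {c ℓ₁ ℓ₂} (F : HeytingField c ℓ₁ ℓ₂) → CharacteristicZero F →
    (n : ℕ) (l* : Plane.Configuration F n 4) →
    let open Plane F n
        open RawRing F[ε]
        l = Plane.Configuration.vectors l*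
    in (Δ* (l 0F) (l 1F) * Δ* (l 2F) (l 3F))
         ≈ ((Δ* (l 0F) (l 2F) * Δ* (l 1F) (l 3F)) + (- (Δ* (l 0F) (l 3F) * Δ* (l 1F) (l 2F))))
-- The whole chain runs in the truncated ring, where `plücker` applies to `det`; only its endpoints
-- are carried over to equality modulo the ideal generated by `ε ^ suc n`.
lemma2p1 F _ n l* = Quotient.≈ₜ⇒≈ (fieldRing F) (suc n) (begin
  Δ* (l 0F) (l 1F) * Δ* (l 2F) (l 3F)
    ≈⟨ Δ*Δ*≈ 0F 1F 2F 3F ⟩
  det (l 0F) (l 1F) * det (l 2F) (l 3F)
    ≈⟨ plücker (l 0F) (l 1F) (l 2F) (l 3F) ⟩
  det (l 0F) (l 2F) * det (l 1F) (l 3F) - det (l 0F) (l 3F) * det (l 1F) (l 2F)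
    ≈⟨ +-cong (Δ*Δ*≈ 0F 2F 1F 3F) (-‿cong (Δ*Δ*≈ 0F 3F 1F 2F)) ⟨
  Δ* (l 0F) (l 2F) * Δ* (l 1F) (l 3F) - Δ* (l 0F) (l 3F) * Δ* (l 1F) (l 2F) ∎)
  where
  open Plane F n using (Δ*; module Configuration)
  open Determinant F n using (Δ*≈det)
  open Truncation (fieldRing F) (suc n) using (commutativeRing)
  open CommutativeRing commutativeRing
  open Plücker commutativeRing using (det; plücker)
  open SetoidReasoning setoid
  l = Configuration.vectors l*

  Δ*Δ*≈ : ∀ i j k m → Δ* (l i) (l j) * Δ* (l k) (l m) ≈ det (l i) (l j) * det (l k) (l m)
  Δ*Δ*≈ i j k m = *-cong (Δ*≈det (l i) (l j)) (Δ*≈det (l k) (l m))
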